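{- Let $B$ be a set and let $\mathcal{T}$ be the monad $\mathcal{T}X=B^*\times X+1$ on $\mathsf{Set}$. Then $(\mathcal{E}_{\mathsf{Kl}(\mathcal{T})},\mathcal{M}_{\mathsf{Kl}(\mathcal{T})})$ is a factorization system on the Kleisli category $\mathsf{Kl}(\mathcal{T})$.
   Context: The monad $\mathcal{T}X=B^*\times X+1$ (with $\bot$ the element of the summand $1$) has unit $x\mapsto(\varepsilon,x)$ and multiplication $(w,(u,x))\mapsto(wu,x)$, $(w,\bot)\mapsto\bot$, $\bot\mapsto\bot$. Objects of $\mathsf{Kl}(\mathcal{T})$ are sets, and a morphism $f\colon X\nrightarrow Y$ is a function $X\to B^*\times Y+1$, composed by Kleisli composition. For $f\colon X\nrightarrow Y$ define $\pi_1(f)\colon X\to B^*+\{\bot\}$ and $\pi_2(f)\colon X\to Y+\{\bot\}$ by $\pi_1(f)(x)=u$, $\pi_2(f)(x)=y$ if $f(x)=(u,y)$, and $\pi_1(f)(x)=\pi_2(f)(x)=\bot$ if $f(x)=\bot$. A function $g\colon X\to Y+\{\bot\}$ is called surjective when for every $y\in Y$ there is $x\in X$ with $g(x)=y$. $\mathcal{E}_{\mathsf{Kl}(\mathcal{T})}$ is the class of morphisms $e\colon X\nrightarrow Y$ with $\pi_2(e)$ surjective in this sense. $\mathcal{M}_{\mathsf{Kl}(\mathcal{T})}$ is the class of morphisms $m\colon X\nrightarrow Y$ such that $\pi_2(m)$ is injective and $\pi_1(m)$ is the constant function with value $\varepsilon$ (so $m$ never takes the value $\bot$). "Factorization system" means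 orthogonal factorization system. -}

module Defs where

open import Data.List.Base using (List; []; _++_)
import Data.List.Relation.Binary.Equality.Setoid as ListEq
import Data.List.Properties as List
open import Data.Maybe.Base as Maybe using (Maybe; just; nothing)
import Data.Maybe.Relation.Binary.Pointwise as MaybeEq
open import Data.Product.Base using (Σ-syntax; ∃-syntax; _×_; _,_; proj₁; proj₂)
open import Data.Product.Relation.Binary.Pointwise.NonDependent using (×-setoid)
open import Function.Bundles using (Func; _⟨$⟩_)
import Function.Construct.Composition as Composition
import Function.Construct.Identity as Identity
open import Function.Definitions using (Injective)
import Function.Relation.Binary.Setoid.Equality as FuncEq
open import Level using (Level; _⊔_; suc)
open import Relation.Binary.Bundles using (Setoid)
open import Relation.Binary.Structures using (IsEquivalence)

-- Categories are enriched in setoids: `_≈_` is the equality of parallel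
-- morphisms, and objects are never compared.

record Category (o h e : Level) : Set (suc (o ⊔ h ⊔ e)) where
  infix  4 _≈_ _⇒_
  infixr 9 _∘_
  field
    Obj : Set o
    _⇒_ : Obj → Obj → Set h
    _≈_ : {X Y : Obj} → X ⇒ Y → X ⇒ Y → Set e
    id  : {X : Obj} → X ⇒ X
    _∘_ : {X Y Z : Obj} → Y ⇒ Z → X ⇒ Y → X ⇒ Z

    isEquivalence : {X Y : Obj} → IsEquivalence (_≈_ {X} {Y})
    ∘-resp-≈  : {X Y Z : Obj} {g g′ : Y ⇒ Z} {f f′ : X ⇒ Y} →
                g ≈ g′ → f ≈ f′ → g ∘ f ≈ g′ ∘ f′
    assoc     : {W X Y Z : Obj} {f : W ⇒ X} {g : X ⇒ Y} {h : Y ⇒ Z} →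
                (h ∘ g) ∘ f ≈ h ∘ (g ∘ f)
    identityˡ : {X Y : Obj} {f : X ⇒ Y} → id ∘ f ≈ f
    identityʳ : {X Y : Obj} {f : X ⇒ Y} → f ∘ id ≈ f

  module ≈ {X Y : Obj} = IsEquivalence (isEquivalence {X} {Y})

  IsIso : {X Y : Obj} → X ⇒ Y → Set (h ⊔ e)
  IsIso {X} {Y} f = Σ[ g ∈ (Y ⇒ X) ] (g ∘ f ≈ id) × (f ∘ g ≈ id)

record Monad {o h e : Level} (C : Category o h e) : Set (o ⊔ h ⊔ e) where
  open Category C
  field
    T₀ : Obj → Obj
    T₁ : {X Y : Obj} → X ⇒ Y → T₀ X ⇒ T₀ Y
    T-resp-≈ : {X Y : Obj} {f g : X ⇒ Y} → f ≈ g → T₁ f ≈ T₁ g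
    T-id     : {X : Obj} → T₁ (id {X}) ≈ id
    T-∘      : {X Y Z : Obj} {f : X ⇒ Y} {g : Y ⇒ Z} →
               T₁ (g ∘ f) ≈ T₁ g ∘ T₁ f

    η : (X : Obj) → X ⇒ T₀ X
    μ : (X : Obj) → T₀ (T₀ X) ⇒ T₀ X
    η-natural : {X Y : Obj} {f : X ⇒ Y} → η Y ∘ f ≈ T₁ f ∘ η X
    μ-natural : {X Y : Obj} {f : X ⇒ Y} → μ Y ∘ T₁ (T₁ f) ≈ T₁ f ∘ μ X

    μ-assoc     : {X : Obj} → μ X ∘ T₁ (μ X) ≈ μ X ∘ μ (T₀ X)
    μ-identityˡ : {X : Obj} → μ X ∘ T₁ (η X) ≈ id
    μ-identityʳ : {X : Obj} → μ X ∘ η (T₀ X) ≈ id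

Kl : {o h e : Level} {C : Category o h e} → Monad C → Category o h e
Kl {C = C} T = record
  { Obj = Obj
  ; _⇒_ = λ X Y → X ⇒ T₀ Y
  ; _≈_ = _≈_
  ; id  = λ {X} → η X
  ; _∘_ = λ {X} {Y} {Z} g f → μ Z ∘ (T₁ g ∘ f)
  ; isEquivalence = isEquivalence
  ; ∘-resp-≈ = λ p q → ∘-resp-≈ ≈.refl (∘-resp-≈ (T-resp-≈ p) q)
  ; assoc = λ {W} {X} {Y} {Z} {f} {g} {h} → kl-assoc f g h
  ; identityˡ = ≈.trans (≈.sym assoc) (≈.trans (∘-resp-≈ μ-identityˡ ≈.refl) identityˡ)
  ; identityʳ = ≈.trans (∘-resp-≈ ≈.refl (≈.sym η-natural))
                  (≈.trans (≈.sym assoc)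
                    (≈.trans (∘-resp-≈ μ-identityʳ ≈.refl) identityˡ))
  }
  where
  open Category C
  open Monad T
  kl-assoc : {W X Y Z : Obj} (f : W ⇒ T₀ X) (g : X ⇒ T₀ Y) (h : Y ⇒ T₀ Z) →
             μ Z ∘ (T₁ (μ Z ∘ (T₁ h ∘ g)) ∘ f) ≈ μ Z ∘ (T₁ h ∘ (μ Y ∘ (T₁ g ∘ f)))
  kl-assoc {W} {X} {Y} {Z} f g h =
    ≈.trans (∘-resp-≈ ≈.refl (∘-resp-≈ (≈.trans T-∘ (∘-resp-≈ ≈.refl T-∘)) ≈.refl))
    (≈.trans (∘-resp-≈ ≈.refl assoc)
    (≈.trans (≈.sym assoc)
    (≈.trans (∘-resp-≈ μ-assoc assoc)
    (≈.trans assoc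
    (∘-resp-≈ ≈.refl
      (≈.trans (≈.sym assoc) (≈.trans (∘-resp-≈ μ-natural ≈.refl) assoc)))))))

MorphismClass : {o h e : Level} → Category o h e → (p : Level) → Set (o ⊔ h ⊔ suc p)
MorphismClass C p = {X Y : Obj} → X ⇒ Y → Set p
  where open Category C

-- Orthogonal factorization systems.  The two `resp-≈` conditions say that
-- the classes are classes of morphisms up to the equality `_≈_`.

record IsFactorizationSystem {o h e p q : Level} (C : Category o h e)
         (E : MorphismClass C p) (M : MorphismClass C q)
         : Set (o ⊔ h ⊔ e ⊔ p ⊔ q) where
  open Category C
  field
    E-resp-≈ : {X Y : Obj} {f g : X ⇒ Y} → f ≈ g → E f → E g
    M-resp-≈ : {X Y : Obj} {f g : X ⇒ Y} → f ≈ g → M f → M g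

    iso⇒E : {X Y : Obj} {f : X ⇒ Y} → IsIso f → E f
    iso⇒M : {X Y : Obj} {f : X ⇒ Y} → IsIso f → M f

    E-∘ : {X Y Z : Obj} {f : X ⇒ Y} {g : Y ⇒ Z} → E f → E g → E (g ∘ f)
    M-∘ : {X Y Z : Obj} {f : X ⇒ Y} {g : Y ⇒ Z} → M f → M g → M (g ∘ f)

    factor : {X Y : Obj} (f : X ⇒ Y) →
             Σ[ Z ∈ Obj ] Σ[ e ∈ (X ⇒ Z) ] Σ[ m ∈ (Z ⇒ Y) ]
               E e × M m × (f ≈ m ∘ e)

    diagonal : {X Y Z W : Obj} {e : X ⇒ Y} {m : Z ⇒ W} → E e → M m →
               (u : X ⇒ Z) (v : Y ⇒ W) → v ∘ e ≈ m ∘ u →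
               Σ[ d ∈ (Y ⇒ Z) ]
                 ((d ∘ e ≈ u) × (m ∘ d ≈ v)) ×
                 ((d′ : Y ⇒ Z) → d′ ∘ e ≈ u → m ∘ d′ ≈ v → d′ ≈ d)

-- Sets are setoids, functions are equality-preserving maps, and two
-- functions are equal when they agree pointwise.

𝐒𝐞𝐭 : (ℓ : Level) → Category (suc ℓ) ℓ ℓ
𝐒𝐞𝐭 ℓ = record
  { Obj = Setoid ℓ ℓ
  ; _⇒_ = Func
  ; _≈_ = λ {X} {Y} → FuncEq._≈_ X Y
  ; id  = λ {X} → Identity.function X
  ; _∘_ = λ g f → Composition.function f g
  ; isEquivalence = λ {X} {Y} → FuncEq.isEquivalence X Y
  ; ∘-resp-≈  = λ {X} {Y} {Z} {g} {g′} {f} {f′} p q x →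
                  Setoid.trans Z (Func.cong g (q x)) (p (f′ ⟨$⟩ x))
  ; assoc     = λ {W} {X} {Y} {Z} x → Setoid.refl Z
  ; identityˡ = λ {X} {Y} x → Setoid.refl Y
  ; identityʳ = λ {X} {Y} x → Setoid.refl Y
  }

module _ {ℓ : Level} where

  infix 30 _*

  _* : Setoid ℓ ℓ → Setoid ℓ ℓ
  B * = ListEq.≋-setoid B

  _+⊥ : Setoid ℓ ℓ → Setoid ℓ ℓ
  X +⊥ = MaybeEq.setoid X

  module _ (B : Setoid ℓ ℓ) where

    private
      module B* where
        open Setoid (B *) public
        open ListEq B public using (++⁺)

    𝒯₀ : Setoid ℓ ℓ → Setoid ℓ ℓ
    𝒯₀ X = ×-setoid (B *) X +⊥

    𝒯₁ : {X Y : Setoid ℓ ℓ} → Func X Y → Func (𝒯₀ X) (𝒯₀ Y)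
    𝒯₁ f = record
      { to   = Maybe.map (λ (w , x) → w , f ⟨$⟩ x)
      ; cong = λ { (MaybeEq.just (p , q)) → MaybeEq.just (p , Func.cong f q)
                 ; MaybeEq.nothing        → MaybeEq.nothing }
      }

    unit : (X : Setoid ℓ ℓ) → Func X (𝒯₀ X)
    unit X = record
      { to   = λ x → just ([] , x)
      ; cong = λ p → MaybeEq.just (B*.refl , p)
      }

    join : {A : Set ℓ} → Maybe (List (Setoid.Carrier B) × Maybe (List (Setoid.Carrier B) × A)) →
           Maybe (List (Setoid.Carrier B) × A)
    join (just (w , just (u , x))) = just (w ++ u , x)
    join (just (w , nothing))      = nothing
    join nothing                   = nothing

    mult : (X : Setoid ℓ ℓ) → Func (𝒯₀ (𝒯₀ X)) (𝒯₀ X)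
    mult X = record
      { to   = join
      ; cong = λ { (MaybeEq.just (p , MaybeEq.just (q , r))) → MaybeEq.just (B*.++⁺ p q , r)
                 ; (MaybeEq.just (p , MaybeEq.nothing))      → MaybeEq.nothing
                 ; MaybeEq.nothing                           → MaybeEq.nothing }
      }

    𝒯 : Monad (𝐒𝐞𝐭 ℓ)
    𝒯 = record
      { T₀ = 𝒯₀
      ; T₁ = 𝒯₁
      ; T-resp-≈ = λ { p (just (w , x)) → MaybeEq.just (B*.refl , p x)
                     ; p nothing        → MaybeEq.nothing }
      ; T-id = λ {X} → λ { (just _) → Setoid.refl (𝒯₀ X) ; nothing → Setoid.refl (𝒯₀ X) }
      ; T-∘  = λ {X} {Y} {Z} → λ { (just _) → Setoid.refl (𝒯₀ Z) ; nothing → Setoid.refl (𝒯₀ Z) }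
      ; η = unit
      ; μ = mult
      ; η-natural = λ {X} {Y} x → Setoid.refl (𝒯₀ Y)
      ; μ-natural = λ {X} {Y} → λ
          { (just (w , just (u , x))) → Setoid.refl (𝒯₀ Y)
          ; (just (w , nothing))      → Setoid.refl (𝒯₀ Y)
          ; nothing                   → Setoid.refl (𝒯₀ Y) }
      ; μ-assoc = λ {X} → λ
          { (just (w , just (u , just (v , x)))) →
              MaybeEq.just (B*.sym (B*.reflexive (List.++-assoc w u v)) , Setoid.refl X)
          ; (just (w , just (u , nothing)))      → Setoid.refl (𝒯₀ X)
          ; (just (w , nothing))                 → Setoid.refl (𝒯₀ X)
          ; nothing                              → Setoid.refl (𝒯₀ X) }
      ; μ-identityˡ = λ {X} → λ
          { (just (w , x)) → MaybeEq.just (B*.reflexive (List.++-identityʳ w) , Setoid.refl X)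
          ; nothing        → Setoid.refl (𝒯₀ X) }
      ; μ-identityʳ = λ {X} → λ
          { (just (w , x)) → Setoid.refl (𝒯₀ X)
          ; nothing        → Setoid.refl (𝒯₀ X) }
      }

    open Category (Kl 𝒯) using () renaming (_⇒_ to _⇸_)

    π₁ : {X Y : Setoid ℓ ℓ} → X ⇸ Y → Func X (B * +⊥)
    π₁ f = record
      { to   = λ x → Maybe.map proj₁ (f ⟨$⟩ x)
      ; cong = λ p → drop (Func.cong f p)
      }
      where
      drop : ∀ {s t} → MaybeEq.Pointwise _ s t → MaybeEq.Pointwise _ (Maybe.map proj₁ s) (Maybe.map proj₁ t)
      drop (MaybeEq.just (p , _)) = MaybeEq.just p
      drop MaybeEq.nothing        = MaybeEq.nothing

    π₂ : {X Y : Setoid ℓ ℓ} → X ⇸ Y → Func X (Y +⊥)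
    π₂ f = record
      { to   = λ x → Maybe.map proj₂ (f ⟨$⟩ x)
      ; cong = λ p → drop (Func.cong f p)
      }
      where
      drop : ∀ {s t} → MaybeEq.Pointwise _ s t → MaybeEq.Pointwise _ (Maybe.map proj₂ s) (Maybe.map proj₂ t)
      drop (MaybeEq.just (_ , q)) = MaybeEq.just q
      drop MaybeEq.nothing        = MaybeEq.nothing

    -- Only the elements of Y, not ⊥, have to be reached.
    ℰ : MorphismClass (Kl 𝒯) ℓ
    ℰ {X} {Y} e = (y : Setoid.Carrier Y) → ∃[ x ] Setoid._≈_ (Y +⊥) (π₂ e ⟨$⟩ x) (just y)

    ℳ : MorphismClass (Kl 𝒯) ℓ
    ℳ {X} {Y} m =
      Injective (Setoid._≈_ X) (Setoid._≈_ (Y +⊥)) (π₂ m ⟨$⟩_) ×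
      ((x : Setoid.Carrier X) → Setoid._≈_ (B * +⊥) (π₁ m ⟨$⟩ x) (just []))

{-# OPTIONS --safe #-}
module Submission where

-- A morphism m of ℳ is total, writes nothing and is injective, so its Kleisli
-- extension 𝒯 Z → 𝒯 W is injective.  A diagonal for v ∘ e ≈ m ∘ u therefore only
-- requires, for each y, a preimage of v y under this extension; it is read off u
-- at a preimage of y under e.  That the diagonal respects equality, its upper
-- triangle and its uniqueness all follow by cancelling m.

open import Defs
open import Data.List.Base using (List; []; _++_)
import Data.List.Properties as List
import Data.List.Relation.Binary.Equality.Setoid as ListEq
open import Data.List.Relation.Binary.Pointwise.Base using ([])
open import Data.Maybe.Base as Maybe using (Maybe; just; nothing)
import Data.Maybe.Relation.Binary.Pointwise as MaybeEq
open import Data.Product.Base using (Σ-syntax; ∃-syntax; _×_; _,_; proj₁; proj₂)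
open import Function.Base using (_on_)
open import Function.Bundles using (Func; _⟨$⟩_)
open import Level using (Level)
open import Relation.Binary.Bundles using (Setoid)
import Relation.Binary.Construct.On as On

module _ {ℓ : Level} (B : Setoid ℓ ℓ) where

  open Category (Kl (𝒯 B))
  open ListEq B using (_≋_; ≋-refl; ≋-reflexive)

  private
    module 𝒯₀ (X : Setoid ℓ ℓ) = Setoid (𝒯₀ B X)
    ∣_∣ = Setoid.Carrier
    Word = List ∣ B ∣

    variable
      X Y Z W : Setoid ℓ ℓ

  -- Kleisli extension and its inversion

  infix 4 _∋_≈ₜ_
  _∋_≈ₜ_ : (X : Setoid ℓ ℓ) → ∣ 𝒯₀ B X ∣ → ∣ 𝒯₀ B X ∣ → Set ℓ
  X ∋ s ≈ₜ t = Setoid._≈_ (𝒯₀ B X) s t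

  -- The Kleisli extension of `f`. By definition `(g ∘ f) ⟨$⟩ x` is `bind g ⟨$⟩ (f ⟨$⟩ x)`, so facts
  -- about `bind` apply to composites without rewriting.
  bind : X ⇒ Y → Func (𝒯₀ B X) (𝒯₀ B Y)
  bind {Y = Y} f = record
    { to   = λ t → mult B Y ⟨$⟩ (𝒯₁ B f ⟨$⟩ t)
    ; cong = λ p → Func.cong (mult B Y) (Func.cong (𝒯₁ B f) p)
    }

  bind-just : (f : X ⇒ Y) {w v : Word} {x : ∣ X ∣} {y : ∣ Y ∣} →
              Y ∋ f ⟨$⟩ x ≈ₜ just (v , y) →
              Y ∋ bind f ⟨$⟩ just (w , x) ≈ₜ just (w ++ v , y)
  bind-just {Y = Y} f p = Func.cong (mult B Y) (MaybeEq.just (≋-refl , p))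

  -- `join` yields `just` only when both layers are `just`. This recovers the intermediate values of
  -- a composite known to be defined at a point, as with an inverse or a commuting square.
  bind-just⁻¹ : (f : X ⇒ Y) (t : ∣ 𝒯₀ B X ∣) {w : Word} {y : ∣ Y ∣} →
                Y ∋ bind f ⟨$⟩ t ≈ₜ just (w , y) →
                ∃[ u ] ∃[ x ] ∃[ v ] (X ∋ t ≈ₜ just (u , x)) ×
                  (Y ∋ f ⟨$⟩ x ≈ₜ just (v , y)) × (u ++ v ≋ w)
  bind-just⁻¹ {X = X} {Y = Y} f (just (u , x)) p with f ⟨$⟩ x in eq | p
  ... | just (v , y) | MaybeEq.just (q , r) =
    u , x , v , 𝒯₀.refl X ,
    𝒯₀.trans Y (𝒯₀.reflexive Y eq) (MaybeEq.just (≋-refl , r)) , q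

  -- Elementwise forms of the two classes

  π₂-just : (f : X ⇒ Y) {x : ∣ X ∣} {w : Word} {y : ∣ Y ∣} →
            Y ∋ f ⟨$⟩ x ≈ₜ just (w , y) →
            Setoid._≈_ (Y +⊥) (π₂ B f ⟨$⟩ x) (just y)
  π₂-just f {x} p with f ⟨$⟩ x | p
  ... | just _ | MaybeEq.just (_ , q) = MaybeEq.just q

  π₂-just⁻¹ : (f : X ⇒ Y) {x : ∣ X ∣} {y : ∣ Y ∣} →
              Setoid._≈_ (Y +⊥) (π₂ B f ⟨$⟩ x) (just y) →
              ∃[ w ] Y ∋ f ⟨$⟩ x ≈ₜ just (w , y)
  π₂-just⁻¹ f {x} p with f ⟨$⟩ x | p
  ... | just (w , _) | MaybeEq.just q = w , MaybeEq.just (≋-refl , q)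

  Surjective : X ⇒ Y → Set ℓ
  Surjective {X} {Y} e = (y : ∣ Y ∣) → ∃[ x ] ∃[ w ] Y ∋ e ⟨$⟩ x ≈ₜ just (w , y)

  ℰ⇒surjective : {e : X ⇒ Y} → ℰ B e → Surjective e
  ℰ⇒surjective {e = e} e∈ℰ y = let x , p = e∈ℰ y in x , π₂-just⁻¹ e p

  surjective⇒ℰ : {e : X ⇒ Y} → Surjective e → ℰ B e
  surjective⇒ℰ {e = e} s y = let x , w , p = s y in x , π₂-just e p

  -- Here `injective` compares whole values of `m`, whereas `ℳ` compares second components only. The
  -- two agree because `pure` makes every written word empty.
  record IsPureInjection (m : X ⇒ Y) : Set ℓ where
    field
      pure      : (x : ∣ X ∣) → ∃[ y ] Y ∋ m ⟨$⟩ x ≈ₜ just ([] , y)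
      injective : {x x′ : ∣ X ∣} → Y ∋ m ⟨$⟩ x ≈ₜ m ⟨$⟩ x′ → Setoid._≈_ X x x′

  open IsPureInjection

  ℳ⇒pureInjection : {m : X ⇒ Y} → ℳ B m → IsPureInjection m
  ℳ⇒pureInjection {X = X} {Y = Y} {m = m} (inj , const) = record
    { pure      = λ x → split (m ⟨$⟩ x) (const x)
    ; injective = λ p → inj (drop p)
    }
    where
    split : (t : ∣ 𝒯₀ B Y ∣) → Setoid._≈_ (B * +⊥) (Maybe.map proj₁ t) (just []) →
            ∃[ y ] Y ∋ t ≈ₜ just ([] , y)
    split (just (_ , y)) (MaybeEq.just p) = y , MaybeEq.just (p , Setoid.refl Y)

    drop : {s t : ∣ 𝒯₀ B Y ∣} → Y ∋ s ≈ₜ t →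
           Setoid._≈_ (Y +⊥) (Maybe.map proj₂ s) (Maybe.map proj₂ t)
    drop (MaybeEq.just (_ , q)) = MaybeEq.just q
    drop MaybeEq.nothing        = MaybeEq.nothing

  pureInjection⇒ℳ : {m : X ⇒ Y} → IsPureInjection m → ℳ B m
  pureInjection⇒ℳ {X = X} {Y = Y} {m = m} m-pi = inj , const
    where
    inj : {x x′ : ∣ X ∣} → Setoid._≈_ (Y +⊥) (π₂ B m ⟨$⟩ x) (π₂ B m ⟨$⟩ x′) → Setoid._≈_ X x x′
    inj {x} {x′} p =
      let y , q = pure m-pi x
          y′ , q′ = pure m-pi x′
          y≈y′ = MaybeEq.drop-just (Setoid.trans (Y +⊥) (Setoid.sym (Y +⊥) (π₂-just m q))
                   (Setoid.trans (Y +⊥) p (π₂-just m q′)))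
      in injective m-pi (𝒯₀.trans Y q
           (𝒯₀.trans Y (MaybeEq.just (≋-refl , y≈y′)) (𝒯₀.sym Y q′)))

    const : (x : ∣ X ∣) → Setoid._≈_ (B * +⊥) (π₁ B m ⟨$⟩ x) (just [])
    const x with m ⟨$⟩ x | pure m-pi x
    ... | just _ | _ , MaybeEq.just (p , _) = MaybeEq.just p

  -- Extensions of pure injections

  bind-pure : {m : X ⇒ Y} → IsPureInjection m → (w : Word) (x : ∣ X ∣) →
              ∃[ y ] (Y ∋ m ⟨$⟩ x ≈ₜ just ([] , y)) × (Y ∋ bind m ⟨$⟩ just (w , x) ≈ₜ just (w , y))
  bind-pure {Y = Y} {m = m} m-pi w x =
    let y , p = pure m-pi x
    in y , p , 𝒯₀.trans Y (bind-just m p)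
         (MaybeEq.just (≋-reflexive (List.++-identityʳ w) , Setoid.refl Y))

  -- Since `m` is total and writes nothing, `bind m` leaves the word unchanged and sends only ⊥ to
  -- ⊥. Words can thus be compared directly, and elements through injectivity of `m`.
  bind-injective : {m : X ⇒ Y} → IsPureInjection m → (s t : ∣ 𝒯₀ B X ∣) →
                   Y ∋ bind m ⟨$⟩ s ≈ₜ bind m ⟨$⟩ t → X ∋ s ≈ₜ t
  bind-injective {Y = Y} m-pi (just (w , x)) (just (w′ , x′)) p
    with y , q , r ← bind-pure m-pi w x
       | y′ , q′ , r′ ← bind-pure m-pi w′ x′
    with MaybeEq.just (w≋w′ , y≈y′) ← 𝒯₀.trans Y (𝒯₀.sym Y r) (𝒯₀.trans Y p r′)
    = MaybeEq.just (w≋w′ , injective m-pi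
        (𝒯₀.trans Y q (𝒯₀.trans Y (MaybeEq.just (≋-refl , y≈y′)) (𝒯₀.sym Y q′))))
  bind-injective {Y = Y} m-pi (just (w , x)) nothing p
    with _ , _ , r ← bind-pure m-pi w x
    with () ← 𝒯₀.trans Y (𝒯₀.sym Y r) p
  bind-injective {Y = Y} m-pi nothing (just (w , x)) p
    with _ , _ , r ← bind-pure m-pi w x
    with () ← 𝒯₀.trans Y p r
  bind-injective m-pi nothing nothing p = MaybeEq.nothing

  -- Closure under equality, isomorphisms and composition

  surjective-resp-≈ : {f g : X ⇒ Y} → f ≈ g → Surjective f → Surjective g
  surjective-resp-≈ {Y = Y} p s y =
    let x , w , q = s y in x , w , 𝒯₀.trans Y (𝒯₀.sym Y (p x)) q

  pureInjection-resp-≈ : {f g : X ⇒ Y} → f ≈ g → IsPureInjection f → IsPureInjection g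
  pureInjection-resp-≈ {Y = Y} p f-pi = record
    { pure      = λ x → let y , q = pure f-pi x in y , 𝒯₀.trans Y (𝒯₀.sym Y (p x)) q
    ; injective = λ {x} {x′} q →
        injective f-pi (𝒯₀.trans Y (p x) (𝒯₀.trans Y q (𝒯₀.sym Y (p x′))))
    }

  iso⇒surjective : {f : X ⇒ Y} → IsIso f → Surjective f
  iso⇒surjective {f = f} (g , _ , f∘g≈id) y =
    let _ , x , v , _ , p , _ = bind-just⁻¹ f (g ⟨$⟩ y) (f∘g≈id y) in x , v , p

  -- The word written by `f` is a prefix of the one written by `g ∘ f`, which is empty; in a free
  -- monoid this forces the prefix to be empty too. Injectivity comes from applying `bind g` to both
  -- sides.
  iso⇒pureInjection : {f : X ⇒ Y} → IsIso f → IsPureInjection f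
  iso⇒pureInjection {X = X} {Y = Y} {f = f} (g , g∘f≈id , _) = record
    { pure      = λ x →
        let u , y , v , p , _ , q = bind-just⁻¹ g (f ⟨$⟩ x) (g∘f≈id x)
        in y , 𝒯₀.trans Y p (MaybeEq.just (conicalˡ u v q , Setoid.refl Y))
    ; injective = λ {x} {x′} p →
        proj₂ (MaybeEq.drop-just (𝒯₀.trans X (𝒯₀.sym X (g∘f≈id x))
          (𝒯₀.trans X (Func.cong (bind g) p) (g∘f≈id x′))))
    }
    where
    conicalˡ : (u v : Word) → u ++ v ≋ [] → u ≋ []
    conicalˡ [] v p = []

  surjective-∘ : {f : X ⇒ Y} {g : Y ⇒ Z} → Surjective f → Surjective g → Surjective (g ∘ f)
  surjective-∘ {Z = Z} {g = g} f-s g-s z =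
    let y , v , q = g-s z
        x , w , p = f-s y
    in x , w ++ v , 𝒯₀.trans Z (Func.cong (bind g) p) (bind-just g q)

  pureInjection-∘ : {f : X ⇒ Y} {g : Y ⇒ Z} →
                    IsPureInjection f → IsPureInjection g → IsPureInjection (g ∘ f)
  pureInjection-∘ {Z = Z} {f = f} {g = g} f-pi g-pi = record
    { pure      = λ x →
        let y , p = pure f-pi x
            z , q = pure g-pi y
        in z , 𝒯₀.trans Z (Func.cong (bind g) p) (bind-just g q)
    ; injective = λ {x} {x′} p →
        injective f-pi (bind-injective g-pi (f ⟨$⟩ x) (f ⟨$⟩ x′) p)
    }

  -- Factorization through the image

  module Image {X Y : Setoid ℓ ℓ} (f : X ⇒ Y) where

    -- Each point carries a preimage, so surjectivity of the corestriction needs no choice; equality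
    -- ignores that preimage, so the inclusion is injective.
    image : Setoid ℓ ℓ
    image = record
      { Carrier       = Σ[ y ∈ ∣ Y ∣ ] ∃[ x ] ∃[ w ] Y ∋ f ⟨$⟩ x ≈ₜ just (w , y)
      ; _≈_           = Setoid._≈_ Y on proj₁
      ; isEquivalence = On.isEquivalence proj₁ (Setoid.isEquivalence Y)
      }

    inclusion : image ⇒ Y
    inclusion = record
      { to   = λ z → just ([] , proj₁ z)
      ; cong = λ p → MaybeEq.just (≋-refl , p)
      }

    inclusion-pureInjection : IsPureInjection inclusion
    inclusion-pureInjection = record
      { pure      = λ z → proj₁ z , 𝒯₀.refl Y
      ; injective = λ p → proj₂ (MaybeEq.drop-just p)
      }

    -- The value `t` is separated from `f ⟨$⟩ x` so that case analysis on `t` keeps the proof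
    -- relating them, which becomes the witness stored in `image`.
    corestrict : (x : ∣ X ∣) (t : ∣ 𝒯₀ B Y ∣) → Y ∋ f ⟨$⟩ x ≈ₜ t → ∣ 𝒯₀ B image ∣
    corestrict x (just (w , y)) p = just (w , y , x , w , p)
    corestrict x nothing        p = nothing

    inclusion-corestrict : (x : ∣ X ∣) (t : ∣ 𝒯₀ B Y ∣) (p : Y ∋ f ⟨$⟩ x ≈ₜ t) →
                           Y ∋ bind inclusion ⟨$⟩ corestrict x t p ≈ₜ t
    inclusion-corestrict x (just (w , y)) p =
      MaybeEq.just (≋-reflexive (List.++-identityʳ w) , Setoid.refl Y)
    inclusion-corestrict x nothing        p = MaybeEq.nothing

    private
      corestriction₀ : ∣ X ∣ → ∣ 𝒯₀ B image ∣
      corestriction₀ x = corestrict x (f ⟨$⟩ x) (𝒯₀.refl Y)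

    factorization : (x : ∣ X ∣) → Y ∋ bind inclusion ⟨$⟩ corestriction₀ x ≈ₜ f ⟨$⟩ x
    factorization x = inclusion-corestrict x (f ⟨$⟩ x) (𝒯₀.refl Y)

    corestriction : X ⇒ image
    corestriction = record
      { to   = corestriction₀
      -- Equal arguments may yield different stored witnesses; cancelling the inclusion reduces the
      -- claim to congruence of `f`.
      ; cong = λ {x} {x′} p → bind-injective inclusion-pureInjection _ _
          (𝒯₀.trans Y (factorization x)
            (𝒯₀.trans Y (Func.cong f p) (𝒯₀.sym Y (factorization x′))))
      }

    corestriction-surjective : Surjective corestriction
    corestriction-surjective z@(y , x , w , p) =
      x , w , bind-injective inclusion-pureInjection (corestriction ⟨$⟩ x) (just (w , z))
        (𝒯₀.trans Y (factorization x) (𝒯₀.trans Y p (𝒯₀.sym Y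
          (MaybeEq.just (≋-reflexive (List.++-identityʳ w) , Setoid.refl Y)))))

  -- Unique diagonals

  module Diagonal {X Y Z W : Setoid ℓ ℓ} {e : X ⇒ Y} {m : Z ⇒ W}
                  (e-s : Surjective e) (m-pi : IsPureInjection m)
                  (u : X ⇒ Z) (v : Y ⇒ W) (square : v ∘ e ≈ m ∘ u) where

    lift : (y : ∣ Y ∣) (t : ∣ 𝒯₀ B W ∣) → W ∋ v ⟨$⟩ y ≈ₜ t →
           ∃[ s ] W ∋ bind m ⟨$⟩ s ≈ₜ t
    lift y nothing        p = nothing , MaybeEq.nothing
    lift y (just (b , a)) p =
      let x , w , q = e-s y
          ve≈ = 𝒯₀.trans W (Func.cong (bind v) q) (bind-just v p)
          -- Since `v ∘ e` is defined at `x`, the square makes `m ∘ u` defined there as well: `u`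
          -- reaches some `z` at `x`, and `m` sends `z` to `a`.
          _ , z , _ , _ , r , _ = bind-just⁻¹ m (u ⟨$⟩ x) (𝒯₀.trans W (𝒯₀.sym W (square x)) ve≈)
          a′ , r′ , s = bind-pure m-pi b z
          a′≈a = proj₂ (MaybeEq.drop-just (𝒯₀.trans W (𝒯₀.sym W r′) r))
      -- The element comes from `u`, but the word is the `b` of `v ⟨$⟩ y`: the word of `u ⟨$⟩ x`
      -- also contains the prefix `w` written by `e`.
      in just (b , z) , 𝒯₀.trans W s (MaybeEq.just (≋-refl , a′≈a))

    private
      diagonal₀ : (y : ∣ Y ∣) → ∃[ s ] W ∋ bind m ⟨$⟩ s ≈ₜ v ⟨$⟩ y
      diagonal₀ y = lift y (v ⟨$⟩ y) (𝒯₀.refl W)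

    diagonal : Y ⇒ Z
    diagonal = record
      { to   = λ y → proj₁ (diagonal₀ y)
      ; cong = λ {y} {y′} p → bind-injective m-pi _ _
          (𝒯₀.trans W (proj₂ (diagonal₀ y))
            (𝒯₀.trans W (Func.cong v p) (𝒯₀.sym W (proj₂ (diagonal₀ y′)))))
      }

    lower : m ∘ diagonal ≈ v
    lower y = proj₂ (diagonal₀ y)

    -- Members of `ℳ` are monomorphisms in the Kleisli category: `m ∘ f` is `f` followed by the
    -- injective map `bind m`.
    cancel-m : {V : Setoid ℓ ℓ} {f g : V ⇒ Z} → m ∘ f ≈ m ∘ g → f ≈ g
    cancel-m {f = f} {g} p x = bind-injective m-pi (f ⟨$⟩ x) (g ⟨$⟩ x) (p x)

    upper : diagonal ∘ e ≈ u
    upper = cancel-m {f = diagonal ∘ e} {u}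
      (≈.trans {i = m ∘ (diagonal ∘ e)} {(m ∘ diagonal) ∘ e} {m ∘ u}
        (≈.sym {x = (m ∘ diagonal) ∘ e} {m ∘ (diagonal ∘ e)} (assoc {f = e} {diagonal} {m}))
        (≈.trans {i = (m ∘ diagonal) ∘ e} {v ∘ e} {m ∘ u}
          (∘-resp-≈ {g = m ∘ diagonal} {v} {e} {e} lower (≈.refl {x = e})) square))

    unique : (d : Y ⇒ Z) → m ∘ d ≈ v → d ≈ diagonal
    unique d p = cancel-m {f = d} {diagonal}
      (λ y → 𝒯₀.trans W (p y) (𝒯₀.sym W (lower y)))

lemma4p8 : {ℓ : Level} (B : Setoid ℓ ℓ) → IsFactorizationSystem (Kl (𝒯 B)) (ℰ B) (ℳ B)
lemma4p8 B = record
  { E-resp-≈ = λ {_} {_} {f} {g} p f∈ℰ → surjective⇒ℰ B {e = g}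
      (surjective-resp-≈ B {f = f} {g} p (ℰ⇒surjective B {e = f} f∈ℰ))
  ; M-resp-≈ = λ {_} {_} {f} {g} p f∈ℳ → pureInjection⇒ℳ B
      (pureInjection-resp-≈ B {f = f} {g} p (ℳ⇒pureInjection B {m = f} f∈ℳ))
  ; iso⇒E    = λ {_} {_} {f} i → surjective⇒ℰ B {e = f} (iso⇒surjective B {f = f} i)
  ; iso⇒M    = λ {_} {_} {f} i → pureInjection⇒ℳ B (iso⇒pureInjection B {f = f} i)
  ; E-∘      = λ {_} {_} {_} {f} {g} f∈ℰ g∈ℰ → surjective⇒ℰ B {e = g ∘ f}
      (surjective-∘ B {f = f} {g} (ℰ⇒surjective B {e = f} f∈ℰ) (ℰ⇒surjective B {e = g} g∈ℰ))
  ; M-∘      = λ {_} {_} {_} {f} {g} f∈ℳ g∈ℳ → pureInjection⇒ℳ B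
      (pureInjection-∘ B (ℳ⇒pureInjection B {m = f} f∈ℳ) (ℳ⇒pureInjection B {m = g} g∈ℳ))
  ; factor   = λ {_} {Y} f → let open Image B f in
      image , corestriction , inclusion ,
      surjective⇒ℰ B {e = corestriction} corestriction-surjective ,
      pureInjection⇒ℳ B inclusion-pureInjection ,
      λ x → Setoid.sym (𝒯₀ B Y) (factorization x)
  ; diagonal = λ {_} {_} {_} {_} {e} {m} e∈ℰ m∈ℳ u v square →
      let module D = Diagonal B {e = e} (ℰ⇒surjective B {e = e} e∈ℰ)
                       (ℳ⇒pureInjection B {m = m} m∈ℳ) u v square
      in D.diagonal , (D.upper , D.lower) , λ d _ → D.unique d
  }
  where open Category (Kl (𝒯 B))
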